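{- Let $n\ge 1$. Modulo the axioms $x_{ij}^2=x_{ij}$ and $x_{ij}x_{ji}=0$ for all distinct $i,j\in[n]$ (where $x_{ji}=1-x_{ij}$), the following equality holds: $$-1=\sum_{m=1}^{n-1}\left(\left(F_{(m+1)(m+1)}-\sum_{j=1}^mF_{jm}F_{(m+1)(m+1)}\right)^2-\sum_{j=1}^m\sum_{k\in[m]\setminus\{j\}}T_{jmk}\right)-\sum_{j=1}^nF_{jn},$$ and it gives a sum of squares proof that the axioms of the ordering principle system $\mathrm{ORD}_n$ are infeasible (that is, each $T_{jmk}$ is a monomial multiple of a transitivity axiom and each $F_{jn}$ is a non-minimality axiom).
   Context: Ordering principle system $\mathrm{ORD}_n$: there is a Boolean variable $x_{ij}$ for each $i,j\in[n]$ with $i<j$; for $i<j$ write $x_{ji}=1-x_{ij}$. The axioms are: for each $i\in[n]$, $\prod_{j\in[n]\setminus\{i\}}x_{ij}=0$ (non-minimality axioms); and for each $i<j<k$ in $[n]$, $x_{ij}x_{jk}x_{ki}=0$ and $x_{kj}x_{ji}x_{ik}=0$ (transitivity axioms). For $1\le j\le m\le n$, $F_{jm}=\prod_{i\in[m]\setminus\{j\}}x_{ji}$ (an empty product is $1$). For $m\in[n-1]$ and distinct $j,k\in[m]$, $$T_{jmk}=F_{jm}\,x_{(m+1)j}\,x_{k(m+1)}\prod_{i\in[k-1]\setminus\{j\}}x_{(m+1)i}.$$ A sum of squares proof of infeasibility of axioms $\{p_i=0\}$ is an equality $-1=\sum_ip_iq_i+\sum_jg_j^2$ (here modulo the Boolean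 axioms) with real polynomials $q_i,g_j$. -}

module Defs where

open import Algebra.Bundles using (CommutativeRing)
open import Algebra.Structures using (IsCommutativeRing)
open import Data.Fin using (Fin; toℕ; _<_)
open import Data.Fin.Properties using (_≟_; <-cmp)
open import Data.List using (List; _++_; map; foldr; filter; concatMap; allFin)
open import Data.Nat as ℕ using (ℕ; suc)
open import Data.Product using (∃-syntax; _×_; _,_)
open import Level using (Level; _⊔_)
open import Relation.Binary.Definitions using (tri<; tri≈; tri>)
open import Relation.Binary.PropositionalEquality using (_≢_)
open import Relation.Nullary using (¬?)

-- K[V] as the free commutative K-algebra on V: formal polynomial expressions,
-- identified exactly by the commutative-ring laws and the ring structure of K.
-- K is an arbitrary commutative ring; the intended instance is the reals.
module Polynomial {c ℓ v : Level} (K : CommutativeRing c ℓ) (V : Set v) where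

  private module K = CommutativeRing K

  infixl 6 _⊕_
  infixl 7 _⊗_
  infix 8 ⊖_
  infix 4 _≋_

  data Poly : Set (c ⊔ v) where
    con : K.Carrier → Poly
    var : V → Poly
    _⊕_ : Poly → Poly → Poly
    _⊗_ : Poly → Poly → Poly
    ⊖_  : Poly → Poly

  data _≋_ : Poly → Poly → Set (c ⊔ ℓ ⊔ v) where
    ≋-refl  : ∀ {p} → p ≋ p
    ≋-sym   : ∀ {p q} → p ≋ q → q ≋ p
    ≋-trans : ∀ {p q r} → p ≋ q → q ≋ r → p ≋ r

    ⊕-cong : ∀ {p p′ q q′} → p ≋ p′ → q ≋ q′ → p ⊕ q ≋ p′ ⊕ q′
    ⊗-cong : ∀ {p p′ q q′} → p ≋ p′ → q ≋ q′ → p ⊗ q ≋ p′ ⊗ q′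
    ⊖-cong : ∀ {p p′} → p ≋ p′ → ⊖ p ≋ ⊖ p′

    ⊕-assoc     : ∀ p q r → (p ⊕ q) ⊕ r ≋ p ⊕ (q ⊕ r)
    ⊕-comm      : ∀ p q → p ⊕ q ≋ q ⊕ p
    ⊕-identityˡ : ∀ p → con K.0# ⊕ p ≋ p
    ⊖-inverseˡ  : ∀ p → (⊖ p) ⊕ p ≋ con K.0#
    ⊗-assoc     : ∀ p q r → (p ⊗ q) ⊗ r ≋ p ⊗ (q ⊗ r)
    ⊗-comm      : ∀ p q → p ⊗ q ≋ q ⊗ p
    ⊗-identityˡ : ∀ p → con K.1# ⊗ p ≋ p
    distribˡ    : ∀ p q r → p ⊗ (q ⊕ r) ≋ (p ⊗ q) ⊕ (p ⊗ r)

    con-cong : ∀ {a b} → a K.≈ b → con a ≋ con b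
    con-+    : ∀ a b → con (a K.+ b) ≋ con a ⊕ con b
    con-*    : ∀ a b → con (a K.* b) ≋ con a ⊗ con b

  isCommutativeRing : IsCommutativeRing _≋_ _⊕_ _⊗_ ⊖_ (con K.0#) (con K.1#)
  isCommutativeRing = record
    { isRing = record
      { +-isAbelianGroup = record
        { isGroup = record
          { isMonoid = record
            { isSemigroup = record
              { isMagma = record
                { isEquivalence = record
                  { refl = ≋-refl ; sym = ≋-sym ; trans = ≋-trans }
                ; ∙-cong = ⊕-cong
                }
              ; assoc = ⊕-assoc
              }
            ; identity = ⊕-identityˡ
                       , λ p → ≋-trans (⊕-comm p _) (⊕-identityˡ p)
            }
          ; inverse = ⊖-inverseˡ
                    , λ p → ≋-trans (⊕-comm p _) (⊖-inverseˡ p)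
          ; ⁻¹-cong = ⊖-cong
          }
        ; comm = ⊕-comm
        }
      ; *-cong = ⊗-cong
      ; *-assoc = ⊗-assoc
      ; *-identity = ⊗-identityˡ
                   , λ p → ≋-trans (⊗-comm p _) (⊗-identityˡ p)
      ; distrib = distribˡ
                , λ p q r → ≋-trans (⊗-comm _ p)
                              (≋-trans (distribˡ p q r)
                                (⊕-cong (⊗-comm p q) (⊗-comm p r)))
      }
    ; *-comm = ⊗-comm
    }

  commutativeRing : CommutativeRing (c ⊔ v) (c ⊔ ℓ ⊔ v)
  commutativeRing = record { isCommutativeRing = isCommutativeRing }

module BigOperators {c ℓ : Level} (R : CommutativeRing c ℓ) where

  open CommutativeRing R

  infixr 5 ∑ ∏

  ∑ : ∀ {a} {A : Set a} → List A → (A → Carrier) → Carrier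
  ∑ xs f = foldr _+_ 0# (map f xs)

  ∏ : ∀ {a} {A : Set a} → List A → (A → Carrier) → Carrier
  ∏ xs f = foldr _*_ 1# (map f xs)

  syntax ∑ xs (λ i → e) = ∑[ i ∈ xs ] e
  syntax ∏ xs (λ i → e) = ∏[ i ∈ xs ] e

  -- p ≡ q modulo the ideal generated by the family g
  CongruentModulo : ∀ {b} {B : Set b} → (B → Carrier) → Carrier → Carrier → Set (b ⊔ c ⊔ ℓ)
  CongruentModulo {B = B} g p q =
    ∃[ cs ] p - q ≈ ∑ {A = B × Carrier} cs (λ (b , r) → g b * r)

  -- A sum of squares proof, modulo the ideal generated by g, that the system
  -- { p a = 0 } is infeasible; an axiom may be listed with several multipliers.
  record SoSProof {a b} {A : Set a} {B : Set b}
                  (g : B → Carrier) (p : A → Carrier) : Set (a ⊔ b ⊔ c ⊔ ℓ) where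
    field
      multiples : List (A × Carrier)
      squares   : List Carrier
      identity  : CongruentModulo g (- 1#)
                    (∑ multiples (λ (a , q) → p a * q) + ∑ squares (λ h → h * h))

record Variable (n : ℕ) : Set where
  constructor mkVariable
  field
    row col  : Fin n
    .row<col : row < col

data BooleanAxiom (n : ℕ) : Set where
  idempotent    : (i j : Fin n) → i ≢ j → BooleanAxiom n
  complementary : (i j : Fin n) → i ≢ j → BooleanAxiom n

data Transitivity (n : ℕ) : Set where
  ascending  : (i j k : Fin n) → i < j → j < k → Transitivity n
  descending : (i j k : Fin n) → i < j → j < k → Transitivity n

data OrdAxiom (n : ℕ) : Set where
  nonMinimality : Fin n → OrdAxiom n
  transitivity  : Transitivity n → OrdAxiom n

-- The element i ∈ [n] is represented by the i' : Fin n with toℕ i' = i - 1.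
module OrderingPrinciple {c ℓ : Level} (K : CommutativeRing c ℓ) (n : ℕ) where

  open Polynomial K (Variable n) public using (Poly; con; var)

  polyRing : CommutativeRing c (c ⊔ ℓ)
  polyRing = Polynomial.commutativeRing K (Variable n)

  open CommutativeRing polyRing public using (_≈_; _+_; _*_; -_; _-_; 0#; 1#)
  open BigOperators polyRing public

  -- x i i is a dummy value: the diagonal is excluded wherever x is used.
  x : Fin n → Fin n → Poly
  x i j with <-cmp i j
  ... | tri< i<j _ _ = var (mkVariable i j i<j)
  ... | tri≈ _ _ _   = 0#
  ... | tri> _ _ j<i = 1# - var (mkVariable j i j<i)

  -- [m] ⊆ [n], for m ≤ n
  [1‥_] : ℕ → List (Fin n)
  [1‥ m ] = filter (λ i → toℕ i ℕ.<? m) (allFin n)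

  -- {2,…,n}: the elements m+1 for m ∈ [n-1]
  [2‥n] : List (Fin n)
  [2‥n] = filter (λ i → 1 ℕ.≤? toℕ i) (allFin n)

  infixl 6 _∖_
  _∖_ : List (Fin n) → Fin n → List (Fin n)
  xs ∖ j = filter (λ i → ¬? (i ≟ j)) xs

  booleanPoly : BooleanAxiom n → Poly
  booleanPoly (idempotent i j _)    = x i j * x i j - x i j
  booleanPoly (complementary i j _) = x i j * x j i

  transitivityPoly : Transitivity n → Poly
  transitivityPoly (ascending i j k _ _)  = x i j * x j k * x k i
  transitivityPoly (descending i j k _ _) = x k j * x j i * x i k

  ordPoly : OrdAxiom n → Poly
  ordPoly (nonMinimality i) = ∏[ j ∈ allFin n ∖ i ] x i j
  ordPoly (transitivity t)  = transitivityPoly t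

  infix 4 _≡ᴮ_
  _≡ᴮ_ : Poly → Poly → Set (c ⊔ ℓ)
  _≡ᴮ_ = CongruentModulo booleanPoly

  F : Fin n → ℕ → Poly
  F j m = ∏[ i ∈ [1‥ m ] ∖ j ] x j i

  -- In T and G the argument s is the element m+1 of [n], so that m = toℕ s;
  -- likewise k - 1 = toℕ k in T.
  T : Fin n → Fin n → Fin n → Poly
  T j s k = F j (toℕ s) * x s j * x k s * (∏[ i ∈ [1‥ toℕ k ] ∖ j ] x s i)

  G : Fin n → Poly
  G s = F s (suc (toℕ s)) - (∑[ j ∈ [1‥ toℕ s ] ] F j (toℕ s) * F s (suc (toℕ s)))

  -- Monomials in the x i j for all i ≢ j, with x j i standing for 1 - x i j.
  record Literal : Set where
    constructor mkLiteral
    field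
      row col : Fin n
      row≢col : row ≢ col

  monomial : List Literal → Poly
  monomial ls = ∏[ l ∈ ls ] x (Literal.row l) (Literal.col l)

  -- The terms of the identity which are not squares.
  nonSquareTerms : List Poly
  nonSquareTerms =
    concatMap (λ s → concatMap (λ j → map (λ k → - T j s k) ([1‥ toℕ s ] ∖ j)) [1‥ toℕ s ]) [2‥n]
    ++ map (λ j → - F j n) (allFin n)

{-# OPTIONS --safe #-}
module Submission where

-- Let S m = ∑_{j ≤ m} F j m. The F j m are orthogonal idempotents modulo the Boolean
-- axioms, hence S m is idempotent and so is the square's base G s = (1 - S m) F s (m+1),
-- where s = m + 1. Splitting off the first k ∈ [m] ∖ j with x k s = 1 shows
-- F j m * x s j = F j m * F s (m+1) + ∑_k T j s k, and F j (m+1) = F j m * (1 - x s j);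
-- summing over j gives G s ² - ∑ T = S (m+1) - S m. The sum over m telescopes to
-- S n - S 1, and S 1 = 1.

open import Defs
open import Algebra.Bundles using (CommutativeRing)
open import Data.Fin using (Fin; zero; suc; toℕ; fromℕ<; _<_)
open import Data.Fin.Properties using (_≟_; <-cmp; <⇒≢; toℕ<n; toℕ-fromℕ<)
open import Data.List using (List; []; _∷_; [_]; _++_; map; filter; concatMap; allFin; tabulate)
open import Data.List.Membership.Propositional using (_∈_)
open import Data.List.Membership.Propositional.Properties using (∈-filter⁺; ∈-filter⁻; ∈-allFin)
open import Data.List.Properties using (filter-all; filter-none; filter-accept; filter-reject; filter-++; filter-≐; map-tabulate; map-++; ++-identityʳ)
open import Data.List.Relation.Binary.Pointwise using (Pointwise; []; _∷_)
open import Data.List.Relation.Unary.All as All using (All; []; _∷_)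
open import Data.List.Relation.Unary.AllPairs using ([]; _∷_)
open import Data.List.Relation.Unary.Any using (here; there)
open import Data.List.Relation.Unary.Unique.Propositional using (Unique)
open import Data.Nat as ℕ using (ℕ; zero; suc; _≤_; z≤n; s≤s; s≤s⁻¹)
open import Data.Product using (Σ-syntax; ∃-syntax; _×_; _,_; proj₁; proj₂)
open import Function using (id; _∘_; case_of_)
open import Level using (_⊔_)
open import Relation.Binary.Definitions using (tri<; tri≈; tri>)
open import Relation.Binary.PropositionalEquality as ≡ using (_≡_; _≢_)
open import Relation.Nullary using (yes; no; ¬?; contradiction)
open import Relation.Unary using (Pred; Decidable)
import Algebra.Properties.AbelianGroup
import Algebra.Properties.Ring
import Algebra.Solver.Ring.NaturalCoefficients.Default
import Data.List.Relation.Unary.All.Properties as All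
import Data.List.Relation.Unary.Unique.Propositional.Properties as Unique
import Data.Nat.Properties as ℕ
import Relation.Binary.Reasoning.Setoid

-- Initial segments of `Fin n` and removal of an element

-- Definitionally equal to [1‥_] and _∖_ of OrderingPrinciple K n, for every K, so that
-- the lemmas below, stated without K, apply to those directly.
below : ∀ n → ℕ → List (Fin n)
below n m = filter (λ i → toℕ i ℕ.<? m) (allFin n)

infixl 6 _without_
_without_ : ∀ {n} → List (Fin n) → Fin n → List (Fin n)
xs without j = filter (λ i → ¬? (i ≟ j)) xs

filter-map : ∀ {a b p} {A : Set a} {B : Set b} {P : Pred B p} (P? : Decidable P) (f : A → B) xs →
             filter P? (map f xs) ≡ map f (filter (P? ∘ f) xs)
filter-map P? f []       = ≡.refl
filter-map P? f (x ∷ xs) with P? (f x)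
... | yes _ = ≡.cong (f x ∷_) (filter-map P? f xs)
... | no  _ = filter-map P? f xs

below-zero : ∀ n → below n 0 ≡ []
below-zero n = filter-none (λ i → toℕ i ℕ.<? 0) (All.universal (λ _ ()) (allFin n))

below-all : ∀ n → below n n ≡ allFin n
below-all n = filter-all (λ i → toℕ i ℕ.<? n) (All.universal toℕ<n (allFin n))

below-suc-suc : ∀ n m → below (suc n) (suc m) ≡ zero ∷ map suc (below n m)
below-suc-suc n m = ≡.cong (zero ∷_) (begin
  filter P? (tabulate suc)          ≡⟨ ≡.cong (filter P?) (map-tabulate id suc) ⟨
  filter P? (map suc (allFin n))    ≡⟨ filter-map P? suc (allFin n) ⟩
  map suc (filter (P? ∘ suc) (allFin n))
    ≡⟨ ≡.cong (map suc) (filter-≐ (P? ∘ suc) (λ i → toℕ i ℕ.<? m) (s≤s⁻¹ , s≤s) (allFin n)) ⟩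
  map suc (below n m) ∎)
  where
  open ≡.≡-Reasoning
  P? : Decidable (λ (i : Fin (suc n)) → toℕ i ℕ.< suc m)
  P? i = toℕ i ℕ.<? suc m

-- The recurrences from m to m + 1 rest on this: with `m = toℕ s`, the element m + 1 is `s` itself
-- and stands last in the list. The induction on `s` goes through the index shift `below-suc-suc`.
below-suc : ∀ {n} (s : Fin n) → below n (suc (toℕ s)) ≡ below n (toℕ s) ++ [ s ]
below-suc {suc n} zero =
  ≡.trans (below-suc-suc n 0)
    (≡.trans (≡.cong (λ xs → zero ∷ map suc xs) (below-zero n))
      (≡.cong (_++ [ zero ]) (≡.sym (below-zero (suc n)))))
below-suc {suc n} (suc s) = begin
  below (suc n) (suc (suc (toℕ s)))                ≡⟨ below-suc-suc n (suc (toℕ s)) ⟩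
  zero ∷ map suc (below n (suc (toℕ s)))           ≡⟨ ≡.cong (λ xs → zero ∷ map suc xs) (below-suc s) ⟩
  zero ∷ map suc (below n (toℕ s) ++ [ s ])        ≡⟨ ≡.cong (zero ∷_) (map-++ suc (below n (toℕ s)) [ s ]) ⟩
  zero ∷ map suc (below n (toℕ s)) ++ [ suc s ]    ≡⟨ ≡.cong (_++ [ suc s ]) (below-suc-suc n (toℕ s)) ⟨
  below (suc n) (suc (toℕ s)) ++ [ suc s ]         ∎
  where open ≡.≡-Reasoning

∈-below⁻ : ∀ {n m i} → i ∈ below n m → toℕ i ℕ.< m
∈-below⁻ {n} {m} i∈ = proj₂ (∈-filter⁻ (λ i → toℕ i ℕ.<? m) {xs = allFin n} i∈)

∈-below⁺ : ∀ {n m i} → toℕ i ℕ.< m → i ∈ below n m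
∈-below⁺ {n} {m} {i} i<m = ∈-filter⁺ (λ i → toℕ i ℕ.<? m) (∈-allFin i) i<m

below-unique : ∀ n m → Unique (below n m)
below-unique n m = Unique.filter⁺ (λ i → toℕ i ℕ.<? m) (Unique.allFin⁺ n)

without-unique : ∀ {n} {xs : List (Fin n)} j → Unique xs → Unique (xs without j)
without-unique j = Unique.filter⁺ (λ i → ¬? (i ≟ j))

∈-without⁻ : ∀ {n} {xs : List (Fin n)} {i j} → i ∈ xs without j → i ∈ xs × i ≢ j
∈-without⁻ {xs = xs} {j = j} i∈ = ∈-filter⁻ (λ i → ¬? (i ≟ j)) {xs = xs} i∈

∈-without⁺ : ∀ {n} {xs : List (Fin n)} {i j} → i ∈ xs → i ≢ j → i ∈ xs without j
∈-without⁺ {j = j} = ∈-filter⁺ (λ i → ¬? (i ≟ j))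

without-∉ : ∀ {n} {xs : List (Fin n)} {j} → All (_≢ j) xs → xs without j ≡ xs
without-∉ {j = j} = filter-all (λ i → ¬? (i ≟ j))

without-snoc-≡ : ∀ {n} (xs : List (Fin n)) s → (xs ++ [ s ]) without s ≡ xs without s
without-snoc-≡ xs s = begin
  (xs ++ [ s ]) without s            ≡⟨ filter-++ (λ i → ¬? (i ≟ s)) xs [ s ] ⟩
  xs without s ++ [ s ] without s    ≡⟨ ≡.cong (xs without s ++_) (filter-reject (λ i → ¬? (i ≟ s)) {xs = []} (λ s≢s → s≢s ≡.refl)) ⟩
  xs without s ++ []                 ≡⟨ ++-identityʳ (xs without s) ⟩
  xs without s                       ∎
  where open ≡.≡-Reasoning

without-snoc-≢ : ∀ {n} (xs : List (Fin n)) {s j} → s ≢ j → (xs ++ [ s ]) without j ≡ xs without j ++ [ s ]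
without-snoc-≢ xs {s} {j} s≢j =
  ≡.trans (filter-++ (λ i → ¬? (i ≟ j)) xs [ s ])
    (≡.cong (xs without j ++_) (filter-accept (λ i → ¬? (i ≟ j)) {xs = []} s≢j))

-- Turns separate existence proofs into one list of witnesses, so that the axiom multiples of the
-- final certificate stay aligned with `nonSquareTerms`.
collect : ∀ {a b r} {A : Set a} {B : Set b} {R : A → B → Set r} {ys} →
          All (λ y → ∃[ x ] R x y) ys → ∃[ xs ] Pointwise R xs ys
collect []              = [] , []
collect ((x , r) ∷ rs) with collect rs
... | xs , rs′ = x ∷ xs , r ∷ rs′

-- Finite sums, products and idempotents in a commutative ring

module RingLemmas {c ℓ} (R : CommutativeRing c ℓ) where

  open CommutativeRing R
  open BigOperators R
  open Algebra.Properties.Ring ring using ([y-z]x≈yx-zx; x[y-z]≈xy-xz)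
  open Algebra.Properties.AbelianGroup +-abelianGroup using (⁻¹-∙-comm; ε⁻¹≈ε)
  open Algebra.Solver.Ring.NaturalCoefficients.Default commutativeSemiring using (solve; _:+_; _:*_; _:=_)
  open Relation.Binary.Reasoning.Setoid setoid

  -- Allows `S-suc` to be proved without subtraction and to be read as a difference afterwards.
  +≈+⇒-≈- : ∀ {a b c d} → a + b ≈ c + d → d - b ≈ a - c
  +≈+⇒-≈- {a} {b} {c} {d} a+b≈c+d = begin
    d - b                  ≈⟨ +-identityˡ (d - b) ⟨
    0# + (d - b)           ≈⟨ +-congʳ (-‿inverseʳ c) ⟨
    -- The solver is one for semirings, so negated terms enter as independent atoms `c′`, `b′`, and
    -- each cancellation is a separate step.
    (c - c) + (d - b)      ≈⟨ solve 4 (λ c d c′ b′ → (c :+ c′) :+ (d :+ b′) := ((c :+ d) :+ b′) :+ c′) refl c d (- c) (- b) ⟩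
    ((c + d) - b) - c      ≈⟨ +-congʳ (+-congʳ a+b≈c+d) ⟨
    ((a + b) - b) - c      ≈⟨ solve 4 (λ a b c′ b′ → ((a :+ b) :+ b′) :+ c′ := (a :+ c′) :+ (b :+ b′)) refl a b (- c) (- b) ⟩
    (a - c) + (b - b)      ≈⟨ +-congˡ (-‿inverseʳ b) ⟩
    (a - c) + 0#           ≈⟨ +-identityʳ (a - c) ⟩
    a - c                  ∎

  -‿telescope : ∀ a b c → (b - a) + (c - b) ≈ c - a
  -‿telescope a b c = begin
    (b - a) + (c - b)  ≈⟨ solve 4 (λ a′ b b′ c → (b :+ a′) :+ (c :+ b′) := (b :+ b′) :+ (c :+ a′)) refl (- a) b (- b) c ⟩
    (b - b) + (c - a)  ≈⟨ +-congʳ (-‿inverseʳ b) ⟩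
    0# + (c - a)       ≈⟨ +-identityˡ (c - a) ⟩
    c - a              ∎

  *-idem : ∀ {a b} → a * a ≈ a → b * b ≈ b → (a * b) * (a * b) ≈ a * b
  *-idem {a} {b} aa bb =
    trans (solve 2 (λ a b → (a :* b) :* (a :* b) := (a :* a) :* (b :* b)) refl a b) (*-cong aa bb)

  -- The element is (1 - e) f, a product of commuting idempotents. In the expansion, the second half
  -- of the product is e f - e f and vanishes.
  idem-difference : ∀ {e f} → e * e ≈ e → f * f ≈ f →
                    (f - e * f) * (f - e * f) ≈ f - e * f
  idem-difference {e} {f} ee ff = begin
    (f - e * f) * (f - e * f)                      ≈⟨ x[y-z]≈xy-xz (f - e * f) f (e * f) ⟩
    (f - e * f) * f - (f - e * f) * (e * f)        ≈⟨ +-cong ([y-z]x≈yx-zx f f (e * f)) (-‿cong ([y-z]x≈yx-zx (e * f) f (e * f))) ⟩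
    (f * f - e * f * f) - (f * (e * f) - e * f * (e * f))
      ≈⟨ +-cong (+-cong ff (-‿cong (trans (*-assoc e f f) (*-congˡ ff))))
                (-‿cong (+-cong fef (-‿cong (*-idem ee ff)))) ⟩
    (f - e * f) - (e * f - e * f)                  ≈⟨ +-congˡ (-‿cong (-‿inverseʳ (e * f))) ⟩
    (f - e * f) - 0#                               ≈⟨ +-congˡ ε⁻¹≈ε ⟩
    (f - e * f) + 0#                               ≈⟨ +-identityʳ (f - e * f) ⟩
    f - e * f                                      ∎
    where
    fef : f * (e * f) ≈ e * f
    fef = trans (solve 2 (λ e f → f :* (e :* f) := e :* (f :* f)) refl e f) (*-congˡ ff)

  module _ {a} {A : Set a} where

    ∑-cong : ∀ {f g : A → Carrier} xs → (∀ {i} → i ∈ xs → f i ≈ g i) → ∑ xs f ≈ ∑ xs g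
    ∑-cong []       f≈g = refl
    ∑-cong (_ ∷ xs) f≈g = +-cong (f≈g (here ≡.refl)) (∑-cong xs (f≈g ∘ there))

    ∑-++ : ∀ xs ys (f : A → Carrier) → ∑ (xs ++ ys) f ≈ ∑ xs f + ∑ ys f
    ∑-++ []       ys f = sym (+-identityˡ _)
    ∑-++ (x ∷ xs) ys f = trans (+-congˡ (∑-++ xs ys f)) (sym (+-assoc _ _ _))

    ∑-snoc : ∀ xs y (f : A → Carrier) → ∑ (xs ++ [ y ]) f ≈ ∑ xs f + f y
    ∑-snoc xs y f = trans (∑-++ xs [ y ] f) (+-congˡ (+-identityʳ (f y)))

    ∑-+ : ∀ xs (f g : A → Carrier) → ∑ xs (λ i → f i + g i) ≈ ∑ xs f + ∑ xs g
    ∑-+ []       f g = sym (+-identityˡ 0#)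
    ∑-+ (x ∷ xs) f g = trans (+-congˡ (∑-+ xs f g))
      (solve 4 (λ a b c d → (a :+ b) :+ (c :+ d) := (a :+ c) :+ (b :+ d)) refl (f x) (g x) (∑ xs f) (∑ xs g))

    ∑-*ˡ : ∀ xs r (f : A → Carrier) → ∑ xs (λ i → r * f i) ≈ r * ∑ xs f
    ∑-*ˡ []       r f = sym (zeroʳ r)
    ∑-*ˡ (x ∷ xs) r f = trans (+-congˡ (∑-*ˡ xs r f)) (sym (distribˡ r _ _))

    ∑-*ʳ : ∀ xs r (f : A → Carrier) → ∑ xs (λ i → f i * r) ≈ ∑ xs f * r
    ∑-*ʳ xs r f = trans (∑-cong xs (λ {i} _ → *-comm (f i) r)) (trans (∑-*ˡ xs r f) (*-comm r _))

    ∑-neg : ∀ xs (f : A → Carrier) → ∑ xs (λ i → - f i) ≈ - ∑ xs f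
    ∑-neg []       f = sym ε⁻¹≈ε
    ∑-neg (x ∷ xs) f = trans (+-congˡ (∑-neg xs f)) (⁻¹-∙-comm _ _)

    ∑-map : ∀ {b} {B : Set b} (h : B → A) xs (f : A → Carrier) → ∑ (map h xs) f ≈ ∑ xs (f ∘ h)
    ∑-map h []       f = refl
    ∑-map h (x ∷ xs) f = +-congˡ (∑-map h xs f)

    ∑-concatMap : ∀ {b} {B : Set b} (h : B → List A) xs (f : A → Carrier) →
                  ∑ (concatMap h xs) f ≈ ∑ xs (λ x → ∑ (h x) f)
    ∑-concatMap h []       f = refl
    ∑-concatMap h (x ∷ xs) f = trans (∑-++ (h x) (concatMap h xs) f) (+-congˡ (∑-concatMap h xs f))

    ∑-pointwise : ∀ {f : A → Carrier} {xs rs} → Pointwise (λ x r → f x ≈ r) xs rs → ∑ xs f ≈ ∑ rs id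
    ∑-pointwise []       = refl
    ∑-pointwise (e ∷ es) = +-cong e (∑-pointwise es)

    ∏-snoc : ∀ xs y (f : A → Carrier) → ∏ (xs ++ [ y ]) f ≈ ∏ xs f * f y
    ∏-snoc []       y f = *-comm (f y) 1#
    ∏-snoc (x ∷ xs) y f = trans (*-congˡ (∏-snoc xs y f)) (sym (*-assoc _ _ _))

    ∏-idem : ∀ {f : A → Carrier} xs → (∀ {i} → i ∈ xs → f i * f i ≈ f i) → ∏ xs f * ∏ xs f ≈ ∏ xs f
    ∏-idem []       ff = *-identityˡ 1#
    ∏-idem (_ ∷ xs) ff = *-idem (ff (here ≡.refl)) (∏-idem xs (ff ∘ there))

    *-∑-zero : ∀ {r} {f : A → Carrier} xs → (∀ {i} → i ∈ xs → r * f i ≈ 0#) → r * ∑ xs f ≈ 0#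
    *-∑-zero {r} []       rf = zeroʳ r
    *-∑-zero {r} (_ ∷ xs) rf = trans (distribˡ r _ _)
      (trans (+-cong (rf (here ≡.refl)) (*-∑-zero xs (rf ∘ there))) (+-identityˡ 0#))

    -- All cross terms of the square vanish. `Unique` ensures that entries at different positions
    -- are different indices, so that orthogonality applies to them.
    ∑-orthogonal-idem : ∀ {f : A → Carrier} {xs} → Unique xs →
                        (∀ {i} → i ∈ xs → f i * f i ≈ f i) →
                        (∀ {i j} → i ∈ xs → j ∈ xs → i ≢ j → f i * f j ≈ 0#) →
                        ∑ xs f * ∑ xs f ≈ ∑ xs f
    ∑-orthogonal-idem {f} {[]} _ _ _ = zeroˡ 0#
    ∑-orthogonal-idem {f} {x ∷ xs} (x∉xs ∷ uniq) idem orth = begin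
      (f x + ∑ xs f) * (f x + ∑ xs f)
        ≈⟨ solve 2 (λ a s → (a :+ s) :* (a :+ s) := (a :* a :+ s :* s) :+ (a :* s :+ a :* s)) refl (f x) (∑ xs f) ⟩
      (f x * f x + ∑ xs f * ∑ xs f) + (f x * ∑ xs f + f x * ∑ xs f)
        ≈⟨ +-cong (+-cong (idem (here ≡.refl)) (∑-orthogonal-idem uniq (idem ∘ there) (λ i∈ j∈ → orth (there i∈) (there j∈))))
                  (+-cong fx*∑≈0 fx*∑≈0) ⟩
      (f x + ∑ xs f) + (0# + 0#)   ≈⟨ +-congˡ (+-identityˡ 0#) ⟩
      (f x + ∑ xs f) + 0#          ≈⟨ +-identityʳ _ ⟩
      f x + ∑ xs f                 ∎
      where
      fx*∑≈0 : f x * ∑ xs f ≈ 0#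
      fx*∑≈0 = *-∑-zero xs (λ j∈ → orth (here ≡.refl) (there j∈) (All.lookup x∉xs j∈))

  -- Since `xs` has no repetitions, `without j` drops exactly one factor.
  ∏-extract : ∀ {n} {xs : List (Fin n)} {j} (f : Fin n → Carrier) → Unique xs → j ∈ xs →
              ∏ xs f ≈ f j * ∏ (xs without j) f
  ∏-extract {xs = x ∷ xs} {j} f (x∉xs ∷ _) (here ≡.refl) =
    *-congˡ (reflexive (≡.cong (λ ys → ∏ ys f) (≡.sym (≡.trans
      (filter-reject (λ i → ¬? (i ≟ j)) (λ j≢j → j≢j ≡.refl))
      (without-∉ (All.map (λ j≢i i≡j → j≢i (≡.sym i≡j)) x∉xs))))))
  ∏-extract {xs = x ∷ xs} {j} f (x∉xs ∷ uniq) (there j∈xs) = begin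
    f x * ∏ xs f                        ≈⟨ *-congˡ (∏-extract f uniq j∈xs) ⟩
    f x * (f j * ∏ (xs without j) f)    ≈⟨ solve 3 (λ a b c → a :* (b :* c) := b :* (a :* c)) refl (f x) (f j) (∏ (xs without j) f) ⟩
    f j * (f x * ∏ (xs without j) f)    ≡⟨ ≡.cong (λ ys → f j * ∏ ys f) (filter-accept (λ i → ¬? (i ≟ j)) (All.lookup x∉xs j∈xs)) ⟨
    f j * ∏ ((x ∷ xs) without j) f      ∎

  ∑-tabulate : ∀ {a} {A : Set a} {n} (g : Fin n → A) (f : A → Carrier) →
               ∑ (tabulate g) f ≈ ∑ (allFin n) (f ∘ g)
  ∑-tabulate {n = n} g f = trans (reflexive (≡.cong (λ xs → ∑ xs f) (≡.sym (map-tabulate id g)))) (∑-map g (allFin n) f)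

  -- The first summand is peeled off and the others are the same sum for `h ∘ suc`; the induction
  -- therefore runs over all `h`.
  ∑-telescope : ∀ n (h : ℕ → Carrier) →
                ∑[ i ∈ allFin n ] (h (suc (toℕ i)) - h (toℕ i)) ≈ h n - h 0
  ∑-telescope zero    h = sym (-‿inverseʳ (h 0))
  ∑-telescope (suc n) h = begin
    (h 1 - h 0) + ∑ (tabulate {n = n} suc) (λ i → h (suc (toℕ i)) - h (toℕ i))
      ≈⟨ +-congˡ (∑-tabulate suc (λ (i : Fin (suc n)) → h (suc (toℕ i)) - h (toℕ i))) ⟩
    (h 1 - h 0) + (∑[ i ∈ allFin n ] (h (suc (suc (toℕ i))) - h (suc (toℕ i))))
      ≈⟨ +-congˡ (∑-telescope n (h ∘ suc)) ⟩
    (h 1 - h 0) + (h (suc n) - h 1)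
      ≈⟨ -‿telescope (h 0) (h 1) (h (suc n)) ⟩
    h (suc n) - h 0 ∎

  module _ {n} (u v : Fin n → Carrier) (j : Fin n) where

    private
      -- For 0/1 values with u = 1 - v and `k ≢ j`, this indicates that `k` is the first index with
      -- v k = 1, the index `j` being passed over.
      before : Fin n → Carrier
      before k = v k * ∏ (below n (toℕ k) without j) u

      total : ℕ → Carrier
      total m = ∏ (below n m without j) u + ∑ (below n m without j) before

      -- If `s` is `j`, the list does not change. Otherwise the old product P splits as P (u s + v
      -- s): the part with `u s` is the new product, and the part with `v s` is the new summand
      -- `before s`.
      total-suc : ∀ s → u s + v s ≈ 1# → total (suc (toℕ s)) ≈ total (toℕ s)
      total-suc s u+v≈1 rewrite below-suc s with s ≟ j
      ... | yes ≡.refl rewrite without-snoc-≡ (below n (toℕ s)) s = refl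
      ... | no s≢j rewrite without-snoc-≢ (below n (toℕ s)) s≢j = begin
        ∏ (xs ++ [ s ]) u + ∑ (xs ++ [ s ]) before   ≈⟨ +-cong (∏-snoc xs s u) (∑-snoc xs s before) ⟩
        ∏ xs u * u s + (∑ xs before + v s * ∏ xs u)
          ≈⟨ solve 4 (λ p u s v → p :* u :+ (s :+ v :* p) := (u :+ v) :* p :+ s) refl (∏ xs u) (u s) (∑ xs before) (v s) ⟩
        (u s + v s) * ∏ xs u + ∑ xs before           ≈⟨ +-congʳ (trans (*-congʳ u+v≈1) (*-identityˡ (∏ xs u))) ⟩
        ∏ xs u + ∑ xs before                         ∎
        where
        xs : List (Fin n)
        xs = below n (toℕ s) without j

    -- For u = 1 - v with values in {0, 1}, either u = 1 on all of [m] ∖ j,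
    -- or there is a unique first k with v k = 1.
    first-failure : ∀ m → m ≤ n → (∀ {k} → toℕ k ℕ.< m → u k + v k ≈ 1#) →
                    ∏ (below n m without j) u + (∑[ k ∈ below n m without j ] (v k * ∏ (below n (toℕ k) without j) u)) ≈ 1#
    first-failure zero    _   _ rewrite below-zero n = +-identityʳ 1#
    first-failure (suc m) m<n u+v≈1 = begin
      total (suc m)          ≡⟨ ≡.cong (total ∘ suc) s≡m ⟨
      total (suc (toℕ s))    ≈⟨ total-suc s (u+v≈1 (ℕ.≤-reflexive (≡.cong suc s≡m))) ⟩
      total (toℕ s)          ≡⟨ ≡.cong total s≡m ⟩
      total m                ≈⟨ first-failure m (ℕ.<⇒≤ m<n) (u+v≈1 ∘ ℕ.m<n⇒m<1+n) ⟩
      1#                     ∎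
      where
      s : Fin n
      s = fromℕ< m<n

      s≡m : toℕ s ≡ m
      s≡m = toℕ-fromℕ< m<n

-- The quotient of a ring by the ideal of a family of generators

module Quotient {b c ℓ} (R : CommutativeRing c ℓ) {B : Set b} (g : B → CommutativeRing.Carrier R) where

  open CommutativeRing R
  open BigOperators R
  open RingLemmas R
  open Algebra.Properties.Ring ring using (-1*x≈-x; [y-z]x≈yx-zx; x[y-z]≈xy-xz)
  open Algebra.Properties.AbelianGroup +-abelianGroup using (⁻¹-∙-comm; ε⁻¹≈ε; x≈y⇒x∙y⁻¹≈ε; ⁻¹-anti-homo‿-)
  open Relation.Binary.Reasoning.Setoid setoid
  open Algebra.Solver.Ring.NaturalCoefficients.Default commutativeSemiring using (solve; _:+_; _:*_; _:=_)

  -- `CongruentModulo g p q` unfolds to `Ideal (p - q)`, so the laws of congruence reduce to closure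
  -- properties of the ideal.
  Ideal : Carrier → Set (b ⊔ c ⊔ ℓ)
  Ideal p = ∃[ cs ] p ≈ ∑ {A = B × Carrier} cs (λ (b , r) → g b * r)

  Ideal-resp : ∀ {p q} → p ≈ q → Ideal p → Ideal q
  Ideal-resp p≈q (cs , e) = cs , trans (sym p≈q) e

  Ideal-+ : ∀ {p q} → Ideal p → Ideal q → Ideal (p + q)
  Ideal-+ (cs , e) (ds , e′) = cs ++ ds , trans (+-cong e e′) (sym (∑-++ cs ds _))

  Ideal-*ˡ : ∀ r {p} → Ideal p → Ideal (r * p)
  Ideal-*ˡ r {p} (cs , e) = map (λ (b , q) → b , r * q) cs , (begin
    r * p                                           ≈⟨ *-congˡ e ⟩
    r * ∑ cs (λ (b , q) → g b * q)                  ≈⟨ ∑-*ˡ cs r _ ⟨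
    ∑ cs (λ (b , q) → r * (g b * q))
      ≈⟨ ∑-cong cs (λ {(b , q)} _ → solve 3 (λ r x q → r :* (x :* q) := x :* (r :* q)) refl r (g b) q) ⟩
    ∑ cs (λ (b , q) → g b * (r * q))                ≈⟨ ∑-map (λ (b , q) → b , r * q) cs _ ⟨
    ∑ (map (λ (b , q) → b , r * q) cs) (λ (b , q) → g b * q) ∎)

  Ideal-neg : ∀ {p} → Ideal p → Ideal (- p)
  Ideal-neg {p} = Ideal-resp (-1*x≈-x p) ∘ Ideal-*ˡ (- 1#)

  infix 4 _≡ᴵ_
  _≡ᴵ_ : Carrier → Carrier → Set (b ⊔ c ⊔ ℓ)
  _≡ᴵ_ = CongruentModulo g

  ≈⇒≡ᴵ : ∀ {p q} → p ≈ q → p ≡ᴵ q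
  ≈⇒≡ᴵ p≈q = [] , x≈y⇒x∙y⁻¹≈ε p≈q

  generator≡ᴵ0 : ∀ b → g b ≡ᴵ 0#
  generator≡ᴵ0 b = (b , 1#) ∷ [] , (begin
    g b - 0#         ≈⟨ +-congˡ ε⁻¹≈ε ⟩
    g b + 0#         ≈⟨ +-congʳ (*-identityʳ (g b)) ⟨
    g b * 1# + 0#    ∎)

  ≡ᴵ-sym : ∀ {p q} → p ≡ᴵ q → q ≡ᴵ p
  ≡ᴵ-sym {p} {q} = Ideal-resp (⁻¹-anti-homo‿- p q) ∘ Ideal-neg

  ≡ᴵ-trans : ∀ {p q r} → p ≡ᴵ q → q ≡ᴵ r → p ≡ᴵ r
  ≡ᴵ-trans {p} {q} {r} p≡q q≡r = Ideal-resp (-‿telescope r q p) (Ideal-+ q≡r p≡q)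

  +-cong-≡ᴵ : ∀ {p p′ q q′} → p ≡ᴵ p′ → q ≡ᴵ q′ → p + q ≡ᴵ p′ + q′
  +-cong-≡ᴵ {p} {p′} {q} {q′} p≡p′ q≡q′ = Ideal-resp
    (trans (solve 4 (λ p p′ q q′ → (p :+ p′) :+ (q :+ q′) := (p :+ q) :+ (p′ :+ q′)) refl p (- p′) q (- q′))
           (+-congˡ (⁻¹-∙-comm p′ q′)))
    (Ideal-+ p≡p′ q≡q′)

  -- One factor is changed at a time, by way of `p * q′`; each difference is then a multiple of an
  -- element of the ideal.
  *-cong-≡ᴵ : ∀ {p p′ q q′} → p ≡ᴵ p′ → q ≡ᴵ q′ → p * q ≡ᴵ p′ * q′
  *-cong-≡ᴵ {p} {p′} {q} {q′} p≡p′ q≡q′ = ≡ᴵ-trans {q = p * q′}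
    (Ideal-resp (x[y-z]≈xy-xz p q q′) (Ideal-*ˡ p q≡q′))
    (Ideal-resp (trans (*-comm q′ (p - p′)) ([y-z]x≈yx-zx q′ p p′)) (Ideal-*ˡ q′ p≡p′))

  neg-cong-≡ᴵ : ∀ {p q} → p ≡ᴵ q → - p ≡ᴵ - q
  neg-cong-≡ᴵ {p} {q} p≡q = Ideal-resp (sym (⁻¹-∙-comm p (- q))) (Ideal-neg p≡q)

  -- Only the equality changes; the carrier and the operations are those of `R`. Hence `∑` and `∏`
  -- are the same in both rings, and `RingLemmas` can be used a second time for congruences.
  quotientRing : CommutativeRing c (b ⊔ c ⊔ ℓ)
  quotientRing = record
    { _≈_ = _≡ᴵ_ ; _+_ = _+_ ; _*_ = _*_ ; -_ = -_ ; 0# = 0# ; 1# = 1#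
    ; isCommutativeRing = record
      { isRing = record
        { +-isAbelianGroup = record
          { isGroup = record
            { isMonoid = record
              { isSemigroup = record
                { isMagma = record
                  { isEquivalence = record { refl = ≈⇒≡ᴵ refl ; sym = ≡ᴵ-sym ; trans = ≡ᴵ-trans }
                  ; ∙-cong = +-cong-≡ᴵ
                  }
                ; assoc = λ p q r → ≈⇒≡ᴵ (+-assoc p q r)
                }
              ; identity = (λ p → ≈⇒≡ᴵ (+-identityˡ p)) , (λ p → ≈⇒≡ᴵ (+-identityʳ p))
              }
            ; inverse = (λ p → ≈⇒≡ᴵ (-‿inverseˡ p)) , (λ p → ≈⇒≡ᴵ (-‿inverseʳ p))
            ; ⁻¹-cong = neg-cong-≡ᴵ
            }
          ; comm = λ p q → ≈⇒≡ᴵ (+-comm p q)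
          }
        ; *-cong = *-cong-≡ᴵ
        ; *-assoc = λ p q r → ≈⇒≡ᴵ (*-assoc p q r)
        ; *-identity = (λ p → ≈⇒≡ᴵ (*-identityˡ p)) , (λ p → ≈⇒≡ᴵ (*-identityʳ p))
        ; distrib = (λ p q r → ≈⇒≡ᴵ (distribˡ p q r)) , (λ p q r → ≈⇒≡ᴵ (distribʳ p q r))
        }
      ; *-comm = λ p q → ≈⇒≡ᴵ (*-comm p q)
      }
    }

-- Boolean relations: `F` and `S` modulo the Boolean axioms

module Telescope {c ℓ} (K : CommutativeRing c ℓ) (n : ℕ) where

  open OrderingPrinciple K n
  open CommutativeRing polyRing hiding (_≈_; _+_; _*_; -_; _-_; 0#; 1#)
  open RingLemmas polyRing
  open Algebra.Properties.Ring ring using (-‿distribʳ-*)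
  open Algebra.Properties.AbelianGroup +-abelianGroup using (⁻¹-∙-comm)
  open Algebra.Solver.Ring.NaturalCoefficients.Default commutativeSemiring using (solve; _:+_; _:*_; _:=_)
  open Relation.Binary.Reasoning.Setoid setoid

  open Quotient polyRing booleanPoly using (quotientRing; ≈⇒≡ᴵ; generator≡ᴵ0)
  private
    module Q = CommutativeRing quotientRing
    module Qₗ = RingLemmas quotientRing

  1-a+a≈1 : ∀ a → (1# - a) + a ≈ 1#
  1-a+a≈1 a = trans (+-assoc 1# (- a) a) (trans (+-congˡ (-‿inverseˡ a)) (+-identityʳ 1#))

  -- An equality of polynomials, because one of the two is by definition 1 minus the other. The two
  -- comparisons may give different order proofs, but `row<col` is irrelevant, so both refer to the
  -- same variable.
  x+xᵀ≈1 : ∀ {i j} → i ≢ j → x i j + x j i ≈ 1#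
  x+xᵀ≈1 {i} {j} i≢j with <-cmp i j | <-cmp j i
  ... | tri< i<j _ _ | tri> _ _ _   = trans (+-comm _ _) (1-a+a≈1 (var (mkVariable i j i<j)))
  ... | tri> _ _ j<i | tri< _ _ _   = 1-a+a≈1 (var (mkVariable j i j<i))
  ... | tri≈ _ i≡j _ | _            = contradiction i≡j i≢j
  ... | _            | tri≈ _ j≡i _ = contradiction (≡.sym j≡i) i≢j
  ... | tri< i<j _ _ | tri< _ _ i≮j = contradiction i<j i≮j
  ... | tri> _ _ j<i | tri> j≮i _ _ = contradiction j<i j≮i

  x-idem : ∀ {i j} → i ≢ j → x i j * x i j ≡ᴮ x i j
  x-idem {i} {j} i≢j = x∙y⁻¹≈ε⇒x≈y (x i j * x i j) (x i j) (generator≡ᴵ0 (idempotent i j i≢j))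
    where open Algebra.Properties.AbelianGroup Q.+-abelianGroup using (x∙y⁻¹≈ε⇒x≈y)

  F-idem : ∀ j m → F j m * F j m ≡ᴮ F j m
  F-idem j m = Qₗ.∏-idem ([1‥ m ] ∖ j) (λ i∈ → x-idem (λ j≡i → proj₂ (∈-without⁻ {xs = [1‥ m ]} i∈) (≡.sym j≡i)))

  F-extract : ∀ {j k m} → j ≢ k → k ∈ [1‥ m ] → F j m ≈ x j k * ∏ ([1‥ m ] ∖ j ∖ k) (x j)
  F-extract {j} {m = m} j≢k k∈ =
    ∏-extract (x j) (without-unique j (below-unique n m)) (∈-without⁺ k∈ (λ k≡j → j≢k (≡.sym k≡j)))

  -- `F j m` has the factor `x j k` and `F k m` the factor `x k j`; their product is a
  -- complementarity axiom.
  F-orthogonal : ∀ {j k m} → j ∈ [1‥ m ] → k ∈ [1‥ m ] → j ≢ k → F j m * F k m ≡ᴮ 0#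
  F-orthogonal {j} {k} {m} j∈ k∈ j≢k = Q.trans
    (≈⇒≡ᴵ (trans (*-cong (F-extract {m = m} j≢k k∈) (F-extract {m = m} k≢j j∈))
                 (solve 4 (λ a b c d → (a :* b) :* (c :* d) := (a :* c) :* (b :* d)) refl (x j k) A (x k j) B)))
    (Q.trans (Q.*-congʳ {A * B} {x j k * x k j} {0#} (generator≡ᴵ0 (complementary j k j≢k))) (Q.zeroˡ (A * B)))
    where
    k≢j : k ≢ j
    k≢j k≡j = j≢k (≡.sym k≡j)

    A B : Poly
    A = ∏ ([1‥ m ] ∖ j ∖ k) (x j)
    B = ∏ ([1‥ m ] ∖ k ∖ j) (x k)

  -- Read `x i j = 1` as "i comes before j". Under a 0/1 assignment `F j m` indicates that j is the
  -- minimum of [m], so `S m` indicates that [m] has a minimum.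
  S : ℕ → Poly
  S m = ∑[ j ∈ [1‥ m ] ] F j m

  S-idem : ∀ m → S m * S m ≡ᴮ S m
  S-idem m = Qₗ.∑-orthogonal-idem (below-unique n m) (λ {j} _ → F-idem j m) (F-orthogonal {m = m})

  -- The recurrence from `S m` to `S (m + 1)`

  F-suc : ∀ {j s} → j < s → F j (suc (toℕ s)) ≈ F j (toℕ s) * x j s
  F-suc {j} {s} j<s = begin
    F j (suc (toℕ s))                         ≡⟨ ≡.cong (λ is → ∏ (is ∖ j) (x j)) (below-suc s) ⟩
    ∏ (([1‥ toℕ s ] ++ [ s ]) ∖ j) (x j)      ≡⟨ ≡.cong (λ is → ∏ is (x j)) (without-snoc-≢ [1‥ toℕ s ] (λ s≡j → <⇒≢ j<s (≡.sym s≡j))) ⟩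
    ∏ ([1‥ toℕ s ] ∖ j ++ [ s ]) (x j)        ≈⟨ ∏-snoc ([1‥ toℕ s ] ∖ j) s (x j) ⟩
    F j (toℕ s) * x j s                       ∎

  F-diagonal : ∀ s → F s (suc (toℕ s)) ≈ ∏ [1‥ toℕ s ] (x s)
  F-diagonal s = reflexive (≡.cong (λ is → ∏ is (x s)) (≡.trans
    (≡.cong (λ is → is ∖ s) (below-suc s))
    (≡.trans (without-snoc-≡ [1‥ toℕ s ] s)
             (without-∉ (All.tabulate (λ i∈ → <⇒≢ (∈-below⁻ {m = toℕ s} i∈)))))))

  -- `F s (m+1)` contains `x s j`, so every term on the left has the factor `F j m * x s j`. The
  -- cofactors are the terms of `first-failure` for u = `x s` and v k = `x k s`, and they add up to
  -- 1.
  F*F+∑T : ∀ {j s} → j < s →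
           F j (toℕ s) * F s (suc (toℕ s)) + (∑[ k ∈ [1‥ toℕ s ] ∖ j ] T j s k) ≈ F j (toℕ s) * x s j
  F*F+∑T {j} {s} j<s = begin
    Fⱼ * F s (suc (toℕ s)) + ∑ is (T j s)
      ≈⟨ +-cong (*-congˡ (trans (F-diagonal s) (∏-extract (x s) (below-unique n (toℕ s)) (∈-below⁺ j<s))))
                (∑-cong is (λ {k} _ → *-assoc (Fⱼ * x s j) (x k s) (∏ ([1‥ toℕ k ] ∖ j) (x s)))) ⟩
    Fⱼ * (x s j * ∏ is (x s)) + (∑[ k ∈ is ] (Fⱼ * x s j * (x k s * ∏ ([1‥ toℕ k ] ∖ j) (x s))))
      ≈⟨ +-cong (sym (*-assoc Fⱼ (x s j) (∏ is (x s))))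
                (∑-*ˡ is (Fⱼ * x s j) (λ k → x k s * ∏ ([1‥ toℕ k ] ∖ j) (x s))) ⟩
    Fⱼ * x s j * ∏ is (x s) + Fⱼ * x s j * (∑[ k ∈ is ] (x k s * ∏ ([1‥ toℕ k ] ∖ j) (x s)))
      ≈⟨ distribˡ (Fⱼ * x s j) (∏ is (x s)) _ ⟨
    Fⱼ * x s j * (∏ is (x s) + (∑[ k ∈ is ] (x k s * ∏ ([1‥ toℕ k ] ∖ j) (x s))))
      ≈⟨ *-congˡ (first-failure (x s) (λ k → x k s) j (toℕ s) (ℕ.<⇒≤ (toℕ<n s))
                   (λ k<s → x+xᵀ≈1 (λ s≡k → <⇒≢ k<s (≡.sym s≡k)))) ⟩
    Fⱼ * x s j * 1#
      ≈⟨ *-identityʳ (Fⱼ * x s j) ⟩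
    Fⱼ * x s j ∎
    where
    Fⱼ : Poly
    Fⱼ = F j (toℕ s)

    is : List (Fin n)
    is = [1‥ toℕ s ] ∖ j

  ∑∑T : Fin n → Poly
  ∑∑T s = ∑[ j ∈ [1‥ toℕ s ] ] ∑[ k ∈ [1‥ toℕ s ] ∖ j ] T j s k

  -- By `S-split`, `S (m+1)` contributes the terms `F j m * x j s`, and `F*F+∑T` gives the terms
  -- `F j m * x s j`. `merge` adds each pair to `F j m`, since either j precedes s or s precedes j.
  S-suc : ∀ s → S (suc (toℕ s)) + (S (toℕ s) * F s (suc (toℕ s)) + ∑∑T s) ≈ S (toℕ s) + F s (suc (toℕ s))
  S-suc s = begin
    S (suc m) + (S m * f + ∑∑T s)
      ≈⟨ +-cong S-split (+-congʳ (sym (∑-*ʳ js f (λ j → F j m)))) ⟩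
    (∑ js (λ j → F j m * x j s) + f) + (∑ js (λ j → F j m * f) + ∑∑T s)
      ≈⟨ +-congˡ (trans (sym (∑-+ js (λ j → F j m * f) _)) (∑-cong js (λ j∈ → F*F+∑T (∈-below⁻ {m = m} j∈)))) ⟩
    (∑ js (λ j → F j m * x j s) + f) + ∑ js (λ j → F j m * x s j)
      ≈⟨ solve 3 (λ a f b → (a :+ f) :+ b := (a :+ b) :+ f) refl (∑ js (λ j → F j m * x j s)) f (∑ js (λ j → F j m * x s j)) ⟩
    (∑ js (λ j → F j m * x j s) + ∑ js (λ j → F j m * x s j)) + f
      ≈⟨ +-congʳ (trans (sym (∑-+ js (λ j → F j m * x j s) (λ j → F j m * x s j))) (∑-cong js merge)) ⟩
    S m + f ∎
    where
    m : ℕ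
    m = toℕ s

    f : Poly
    f = F s (suc m)

    js : List (Fin n)
    js = [1‥ m ]

    S-split : S (suc m) ≈ ∑ js (λ j → F j m * x j s) + f
    S-split = begin
      S (suc m)                                ≡⟨ ≡.cong (λ is → ∑ is (λ j → F j (suc m))) (below-suc s) ⟩
      ∑ (js ++ [ s ]) (λ j → F j (suc m))      ≈⟨ ∑-snoc js s (λ j → F j (suc m)) ⟩
      ∑ js (λ j → F j (suc m)) + f             ≈⟨ +-congʳ (∑-cong js (λ j∈ → F-suc (∈-below⁻ {m = m} j∈))) ⟩
      ∑ js (λ j → F j m * x j s) + f           ∎

    merge : ∀ {j} → j ∈ js → F j m * x j s + F j m * x s j ≈ F j m
    merge {j} j∈ = trans (sym (distribˡ (F j m) (x j s) (x s j)))
      (trans (*-congˡ (x+xᵀ≈1 (<⇒≢ (∈-below⁻ {m = m} j∈)))) (*-identityʳ (F j m)))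

  -- The Boolean axioms enter the identity here, through the idempotence of `S m` and `F s (m+1)`;
  -- the remaining steps of the recurrence are equalities of polynomials.
  G-square : ∀ s → G s * G s ≡ᴮ F s (suc (toℕ s)) - S (toℕ s) * F s (suc (toℕ s))
  G-square s = Q.trans (≈⇒≡ᴵ (*-cong G≈ G≈)) (Qₗ.idem-difference (S-idem (toℕ s)) (F-idem s (suc (toℕ s))))
    where
    G≈ : G s ≈ F s (suc (toℕ s)) - S (toℕ s) * F s (suc (toℕ s))
    G≈ = +-congˡ (-‿cong (∑-*ʳ [1‥ toℕ s ] (F s (suc (toℕ s))) (λ j → F j (toℕ s))))

  square-minus-T : ∀ s → G s * G s - ∑∑T s ≡ᴮ S (suc (toℕ s)) - S (toℕ s)
  square-minus-T s = Q.trans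
    (Q.+-congʳ { - ∑∑T s} (G-square s))
    (≈⇒≡ᴵ (begin
      (f - S (toℕ s) * f) - ∑∑T s      ≈⟨ +-assoc f (- (S (toℕ s) * f)) (- ∑∑T s) ⟩
      f + (- (S (toℕ s) * f) - ∑∑T s)  ≈⟨ +-congˡ (⁻¹-∙-comm (S (toℕ s) * f) (∑∑T s)) ⟩
      f - (S (toℕ s) * f + ∑∑T s)      ≈⟨ +≈+⇒-≈- (S-suc s) ⟩
      S (suc (toℕ s)) - S (toℕ s)      ∎))
    where
    f : Poly
    f = F s (suc (toℕ s))

  -- The non-square terms as multiples of the axioms

  F-nonMinimality : ∀ j → F j n ≈ ordPoly (nonMinimality j)
  F-nonMinimality j = reflexive (≡.cong (λ is → ∏ (is ∖ j) (x j)) (below-all n))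

  ∏-literals : ∀ {i} js → All (i ≢_) js → ∃[ ls ] ∏ js (x i) ≡ monomial ls
  ∏-literals         []       []            = [] , ≡.refl
  ∏-literals {i = i} (j ∷ js) (i≢j ∷ i≢js) with ∏-literals js i≢js
  ... | ls , eq = mkLiteral i j i≢j ∷ ls , ≡.cong (x i j *_) eq

  monomial-++ : ∀ ls ls′ → monomial (ls ++ ls′) ≈ monomial ls * monomial ls′
  monomial-++ []       ls′ = sym (*-identityˡ (monomial ls′))
  monomial-++ (l ∷ ls) ls′ = trans (*-congˡ (monomial-++ ls ls′)) (sym (*-assoc _ _ _))

  -- The factors run round the cycle j, k, s with `s` the largest. For j < k this is the ascending
  -- axiom as it stands; for k < j it is a rotation of the descending axiom of k < j < s.
  cyclic-transitivity : ∀ {j k s} → j < s → k < s → j ≢ k →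
                        ∃[ t ] x j k * x k s * x s j ≈ transitivityPoly t
  cyclic-transitivity {j} {k} {s} j<s k<s j≢k = case <-cmp j k of λ where
    (tri< j<k _ _) → ascending j k s j<k k<s , refl
    (tri≈ _ j≡k _) → contradiction j≡k j≢k
    (tri> _ _ k<j) → descending k j s k<j j<s
                   , solve 3 (λ a b c → a :* b :* c := c :* a :* b) refl (x j k) (x k s) (x s j)

  -- `T j s k` shows two edges of the cycle, `x s j` and `x k s`; the third, `x j k`, is a factor of
  -- `F j m` because k is in [m]. All other factors form the monomial.
  T-transitivity : ∀ s j k → j < s → k < s → j ≢ k →
                   ∃[ ls ] ∃[ t ] T j s k ≈ monomial ls * transitivityPoly t
  T-transitivity s j k j<s k<s j≢k
    with cyclic-transitivity j<s k<s j≢k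
       | ∏-literals {j} ([1‥ toℕ s ] ∖ j ∖ k)
           (All.tabulate (λ i∈ j≡i → proj₂ (∈-without⁻ {xs = [1‥ toℕ s ]} (proj₁ (∈-without⁻ {xs = [1‥ toℕ s ] ∖ j} i∈))) (≡.sym j≡i)))
       | ∏-literals {s} ([1‥ toℕ k ] ∖ j)
           -- These literals are off the diagonal because i < k < s.
           (All.tabulate (λ i∈ s≡i → <⇒≢ (ℕ.<-trans (∈-below⁻ {m = toℕ k} (proj₁ (∈-without⁻ {xs = [1‥ toℕ k ]} i∈))) k<s) (≡.sym s≡i)))
  ... | t , cycle | ls , eq | ls′ , eq′ = ls ++ ls′ , t , (begin
    F j (toℕ s) * x s j * x k s * B
      ≈⟨ *-congʳ (*-congʳ (*-congʳ (F-extract {m = toℕ s} j≢k (∈-below⁺ k<s)))) ⟩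
    (x j k * A) * x s j * x k s * B
      ≈⟨ solve 5 (λ jk a sj ks b → (jk :* a) :* sj :* ks :* b := (a :* b) :* (jk :* ks :* sj)) refl (x j k) A (x s j) (x k s) B ⟩
    (A * B) * (x j k * x k s * x s j)
      ≈⟨ *-cong (*-cong (reflexive eq) (reflexive eq′)) cycle ⟩
    (monomial ls * monomial ls′) * transitivityPoly t
      ≈⟨ *-congʳ (monomial-++ ls ls′) ⟨
    monomial (ls ++ ls′) * transitivityPoly t ∎)
    where
    A B : Poly
    A = ∏ ([1‥ toℕ s ] ∖ j ∖ k) (x j)
    B = ∏ ([1‥ toℕ k ] ∖ j) (x s)

  AxiomMultiple : OrdAxiom n × Poly → Poly → Set (c ⊔ ℓ)
  AxiomMultiple (a , q) r = ordPoly a * q ≈ r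

  -T-axiomMultiple : ∀ {s j k} → j < s → k < s → j ≢ k → ∃[ aq ] AxiomMultiple aq (- T j s k)
  -T-axiomMultiple {s} {j} {k} j<s k<s j≢k =
    let (ls , t , eq) = T-transitivity s j k j<s k<s j≢k in (transitivity t , - monomial ls) , (begin
    transitivityPoly t * - monomial ls     ≈⟨ -‿distribʳ-* (transitivityPoly t) (monomial ls) ⟨
    - (transitivityPoly t * monomial ls)   ≈⟨ -‿cong (trans (*-comm (transitivityPoly t) (monomial ls)) (sym eq)) ⟩
    - T j s k                              ∎)

  -F-axiomMultiple : ∀ j → ∃[ aq ] AxiomMultiple aq (- F j n)
  -F-axiomMultiple j = (nonMinimality j , - 1#) , (begin
    ordPoly (nonMinimality j) * - 1#    ≈⟨ -‿distribʳ-* (ordPoly (nonMinimality j)) 1# ⟨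
    - (ordPoly (nonMinimality j) * 1#)  ≈⟨ -‿cong (trans (*-identityʳ (ordPoly (nonMinimality j))) (sym (F-nonMinimality j))) ⟩
    - F j n                             ∎)

  nonSquareTerms-axiomMultiples : All (λ r → ∃[ aq ] AxiomMultiple aq r) nonSquareTerms
  nonSquareTerms-axiomMultiples = All.++⁺
    (All.concat⁺ (All.map⁺ (All.universal (λ s →
      All.concat⁺ (All.map⁺ (All.tabulate (λ {j} j∈ →
        All.map⁺ (All.tabulate (λ {k} k∈ → let (k∈ₛ , k≢j) = ∈-without⁻ {xs = [1‥ toℕ s ]} k∈ in
          -T-axiomMultiple (∈-below⁻ {m = toℕ s} j∈) (∈-below⁻ {m = toℕ s} k∈ₛ) (λ j≡k → k≢j (≡.sym j≡k)))))))) [2‥n])))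
    (All.map⁺ (All.universal -F-axiomMultiple (allFin n)))

  -- Regrouping the identity into axiom multiples and squares

  ∑-nonSquareTerms : ∑ nonSquareTerms id ≈ - (∑[ s ∈ [2‥n] ] ∑∑T s) - (∑[ j ∈ allFin n ] F j n)
  ∑-nonSquareTerms = trans (∑-++ Ts (map (λ j → - F j n) (allFin n)) id) (+-cong
    (begin
      ∑ Ts id
        ≈⟨ ∑-concatMap _ [2‥n] id ⟩
      ∑[ s ∈ [2‥n] ] ∑ (concatMap (λ j → map (λ k → - T j s k) ([1‥ toℕ s ] ∖ j)) [1‥ toℕ s ]) id
        ≈⟨ ∑-cong [2‥n] (λ {s} _ → ∑-T s) ⟩
      ∑[ s ∈ [2‥n] ] - ∑∑T s
        ≈⟨ ∑-neg [2‥n] ∑∑T ⟩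
      - (∑[ s ∈ [2‥n] ] ∑∑T s) ∎)
    (trans (∑-map (λ j → - F j n) (allFin n) id) (∑-neg (allFin n) (λ j → F j n))))
    where
    Ts : List Poly
    Ts = concatMap (λ s → concatMap (λ j → map (λ k → - T j s k) ([1‥ toℕ s ] ∖ j)) [1‥ toℕ s ]) [2‥n]

    ∑-T : ∀ s → ∑ (concatMap (λ j → map (λ k → - T j s k) ([1‥ toℕ s ] ∖ j)) [1‥ toℕ s ]) id ≈ - ∑∑T s
    ∑-T s = begin
      ∑ (concatMap (λ j → map (λ k → - T j s k) ([1‥ toℕ s ] ∖ j)) [1‥ toℕ s ]) id
        ≈⟨ ∑-concatMap _ [1‥ toℕ s ] id ⟩
      ∑[ j ∈ [1‥ toℕ s ] ] ∑ (map (λ k → - T j s k) ([1‥ toℕ s ] ∖ j)) id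
        ≈⟨ ∑-cong [1‥ toℕ s ] (λ {j} _ →
             trans (∑-map (λ k → - T j s k) ([1‥ toℕ s ] ∖ j) id) (∑-neg ([1‥ toℕ s ] ∖ j) (T j s))) ⟩
      ∑[ j ∈ [1‥ toℕ s ] ] - (∑[ k ∈ [1‥ toℕ s ] ∖ j ] T j s k)
        ≈⟨ ∑-neg [1‥ toℕ s ] _ ⟩
      - ∑∑T s ∎

  -- Connects the displayed form of the identity, with its terms nested by m, to the shape that
  -- `SoSProof` requires: one sum of multiples plus one sum of squares.
  identity-regrouped :
    (∑[ s ∈ [2‥n] ] (G s * G s - ∑∑T s)) - (∑[ j ∈ allFin n ] F j n)
      ≈ ∑ nonSquareTerms id + (∑[ h ∈ map G [2‥n] ] h * h)
  identity-regrouped = begin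
    (∑[ s ∈ [2‥n] ] (G s * G s - ∑∑T s)) - ∑F
      ≈⟨ +-congʳ (trans (∑-+ [2‥n] (λ s → G s * G s) (λ s → - ∑∑T s)) (+-congˡ (∑-neg [2‥n] ∑∑T))) ⟩
    ((∑[ s ∈ [2‥n] ] G s * G s) - (∑[ s ∈ [2‥n] ] ∑∑T s)) - ∑F
      ≈⟨ solve 3 (λ g t f → (g :+ t) :+ f := (t :+ f) :+ g) refl (∑[ s ∈ [2‥n] ] G s * G s) (- (∑[ s ∈ [2‥n] ] ∑∑T s)) (- ∑F) ⟩
    (- (∑[ s ∈ [2‥n] ] ∑∑T s) - ∑F) + (∑[ s ∈ [2‥n] ] G s * G s)
      ≈⟨ +-cong ∑-nonSquareTerms (∑-map G [2‥n] (λ h → h * h)) ⟨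
    ∑ nonSquareTerms id + (∑[ h ∈ map G [2‥n] ] h * h) ∎
    where
    ∑F : Poly
    ∑F = ∑[ j ∈ allFin n ] F j n

-- Summation over m and the final identity

module Identity {c ℓ} (K : CommutativeRing c ℓ) (n : ℕ) where

  open OrderingPrinciple K (suc n)
  open Telescope K (suc n)
  open CommutativeRing polyRing using (trans; reflexive; setoid; +-cong; +-congʳ; -‿cong; +-identityʳ; +-abelianGroup)
  open Quotient polyRing booleanPoly using (quotientRing; ≈⇒≡ᴵ)
  private
    module Q = CommutativeRing quotientRing
    module Qₗ = RingLemmas quotientRing

  [2‥n]≡map-suc : [2‥n] ≡ map suc (allFin n)
  [2‥n]≡map-suc = ≡.trans
    -- The head `zero` is rejected by computation, so `filter-all` concerns only the remaining
    -- `tabulate suc`.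
    (filter-all (λ i → 1 ℕ.≤? toℕ i) (All.tabulate⁺ {f = suc} (λ _ → s≤s z≤n)))
    (≡.sym (map-tabulate id suc))

  -- The only summand is an empty product: a one-element set has a minimum. This is the source of
  -- the constant -1.
  S-1 : S 1 ≈ 1#
  S-1 = trans (reflexive (≡.cong (λ is → ∑ is (λ j → ∏ (is ∖ j) (x j))) [1‥1]≡[zero])) (+-identityʳ 1#)
    where
    [1‥1]≡[zero] : [1‥ 1 ] ≡ [ zero ]
    [1‥1]≡[zero] = ≡.trans (below-suc-suc n 0) (≡.cong (λ is → zero ∷ map suc is) (below-zero n))

  S-n : S (suc n) ≈ ∑[ j ∈ allFin (suc n) ] F j (suc n)
  S-n = reflexive (≡.cong (λ js → ∑ js (λ j → F j (suc n))) (below-all (suc n)))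

  ∑-square-minus-T : ∑[ s ∈ [2‥n] ] (G s * G s - ∑∑T s) ≡ᴮ S (suc n) - S 1
  ∑-square-minus-T = Q.trans
    (Qₗ.∑-cong {f = λ s → G s * G s - ∑∑T s} {g = λ s → S (suc (toℕ s)) - S (toℕ s)} [2‥n] (λ {s} _ → square-minus-T s))
    (≈⇒≡ᴵ (begin
      ∑[ s ∈ [2‥n] ] (S (suc (toℕ s)) - S (toℕ s))
        ≡⟨ ≡.cong (λ ss → ∑ ss (λ s → S (suc (toℕ s)) - S (toℕ s))) [2‥n]≡map-suc ⟩
      ∑ (map suc (allFin n)) (λ s → S (suc (toℕ s)) - S (toℕ s))
        ≈⟨ ∑-map suc (allFin n) (λ s → S (suc (toℕ s)) - S (toℕ s)) ⟩
      ∑[ i ∈ allFin n ] (S (suc (suc (toℕ i))) - S (suc (toℕ i)))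
        -- The sum starts at m = 1, hence the shift by `suc` and the lower end `S 1` instead of
        -- `S 0`.
        ≈⟨ ∑-telescope n (S ∘ suc) ⟩
      S (suc n) - S 1 ∎))
    where
    open RingLemmas polyRing using (∑-map; ∑-telescope)
    open Relation.Binary.Reasoning.Setoid setoid

  -- `S n` is exactly the sum of the non-minimality terms and cancels against it; what is left is
  -- `- S 1`.
  identity : - 1# ≡ᴮ (∑[ s ∈ [2‥n] ] (G s * G s - ∑∑T s)) - (∑[ j ∈ allFin (suc n) ] F j (suc n))
  identity = Q.sym (Q.trans
    (Q.+-congʳ { - ∑F} ∑-square-minus-T)
    (≈⇒≡ᴵ (begin
      (S (suc n) - S 1) - ∑F   ≈⟨ +-congʳ (+-cong S-n (-‿cong S-1)) ⟩
      (∑F - 1#) - ∑F           ≈⟨ xyx⁻¹≈y ∑F (- 1#) ⟩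
      - 1#                     ∎)))
    where
    open Algebra.Properties.AbelianGroup +-abelianGroup using (xyx⁻¹≈y)
    open Relation.Binary.Reasoning.Setoid setoid
    ∑F : Poly
    ∑F = ∑[ j ∈ allFin (suc n) ] F j (suc n)

theorem5 : ∀ {c ℓ} (K : CommutativeRing c ℓ) (n : ℕ) → 1 ≤ n →
    let open OrderingPrinciple K n in
    (- 1# ≡ᴮ
    (∑[ s ∈ [2‥n] ]
    (G s * G s - (∑[ j ∈ [1‥ toℕ s ] ] ∑[ k ∈ [1‥ toℕ s ] ∖ j ] T j s k)))
    - (∑[ j ∈ allFin n ] F j n))
    ×
    (∀ (s j k : Fin n) → j < s → k < s → j ≢ k →
    ∃[ ls ] ∃[ t ] T j s k ≈ monomial ls * transitivityPoly t)
    ×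
    (∀ (j : Fin n) → F j n ≈ ordPoly (nonMinimality j))
    ×
    (Σ[ P ∈ SoSProof booleanPoly ordPoly ]
    (SoSProof.squares P ≡ map G [2‥n]
    × Pointwise (λ (a , q) r → ordPoly a * q ≈ r) (SoSProof.multiples P) nonSquareTerms))
theorem5 K (suc n) _ =
    identity
  , T-transitivity
  , F-nonMinimality
  , record
      { multiples = multiples
      ; squares   = map G [2‥n]
      -- `certified` replaces each non-square term by an axiom times its multiplier, with the sign
      -- absorbed in the multiplier.
      ; identity  = Q.trans identity (≈⇒≡ᴵ (trans identity-regrouped (+-congʳ (sym (∑-pointwise certified)))))
      }
  , ≡.refl
  , certified
  where
  open OrderingPrinciple K (suc n)
  open Telescope K (suc n)
  open Identity K n
  open CommutativeRing polyRing using (trans; sym; +-congʳ)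
  open RingLemmas polyRing using (∑-pointwise)
  open Quotient polyRing booleanPoly using (quotientRing; ≈⇒≡ᴵ)
  module Q = CommutativeRing quotientRing

  multiples : List (OrdAxiom (suc n) × Poly)
  multiples = proj₁ (collect nonSquareTerms-axiomMultiples)

  certified : Pointwise AxiomMultiple multiples nonSquareTerms
  certified = proj₂ (collect nonSquareTerms-axiomMultiples)
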